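{- Let $n\ge4$. Then the distribution $G^3_{n,1/2}$ is not pairwise independent.
   Context: For an integer $k$, $G^k_{n,1/2}$ is the distribution on graphs on $n$ labeled vertices obtained by conditioning the Erdős–Rényi distribution $G_{n,1/2}$ on the event that the number of edges is divisible by $k$ (equivalently, the uniform distribution on graphs on $n$ labeled vertices whose number of edges is divisible by $k$). With $X_e$ the event that potential edge $e$ is present, a distribution is pairwise independent if $X_e$ and $X_f$ are independent for every pair of potential edges $e,f$ sharing no endpoint. -}

module Defs where

open import Data.Bool using (Bool; true; false; _∧_)
open import Data.Nat using (ℕ; zero; suc; _<_; _<?_)
open import Data.Nat.Divisibility using (_∣_; _∣?_)
open import Data.Fin using (Fin; toℕ)
open import Data.Fin.Subset using (Subset; inside; outside; ∣_∣; _∈_)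
open import Data.Fin.Subset.Properties using (_∈?_)
open import Data.Product using (_×_; _,_; proj₁; proj₂)
open import Data.List using (List; []; _∷_; map; _++_; filter; length; allFin; concatMap)
open import Data.Vec using (Vec; _∷_; []; fromList; lookup)
open import Data.Integer using (+_)
open import Data.Rational using (ℚ; 0ℚ; _/_)
open import Relation.Nullary using (Dec; ¬_)
open import Relation.Nullary.Decidable using (⌊_⌋)
open import Relation.Binary.PropositionalEquality using (_≡_; _≢_)

-- Probability of a (boolean) event under the uniform distribution on the
-- finite list S (S is a list without repetitions in our use).
-- For an empty S (never used) we return 0.
Pr : {A : Set} → List A → (A → Bool) → ℚ
Pr S P with length S
... | zero  = 0ℚ
... | suc k = (+ length (filter (λ x → Data.Bool._≟_ (P x) true) S)) / suc k

edgeList : (n : ℕ) → List (Fin n × Fin n)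
edgeList n = filter (λ p → toℕ (proj₁ p) <? toℕ (proj₂ p))
                    (concatMap (λ i → map (λ j → (i , j)) (allFin n)) (allFin n))

E : ℕ → ℕ
E n = length (edgeList n)

Edge : ℕ → Set
Edge n = Fin (E n)

ends : (n : ℕ) → Edge n → Fin n × Fin n
ends n e = lookup (fromList (edgeList n)) e

Graph : ℕ → Set
Graph n = Subset (E n)

edgeCount : (n : ℕ) → Graph n → ℕ
edgeCount n g = ∣ g ∣

allSubsets : (m : ℕ) → List (Subset m)
allSubsets zero    = [] ∷ []
allSubsets (suc m) = map (inside ∷_) (allSubsets m) ++ map (outside ∷_) (allSubsets m)

allGraphs : (n : ℕ) → List (Graph n)
allGraphs n = allSubsets (E n)

-- Support of G^k_{n,1/2}: graphs whose number of edges is divisible by k.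
-- G^k_{n,1/2} is the uniform distribution on this list.
Gk : (k n : ℕ) → List (Graph n)
Gk k n = filter (λ g → k ∣? edgeCount n g) (allGraphs n)

X : (n : ℕ) → Edge n → Graph n → Bool
X n e g = ⌊ e ∈? g ⌋

Disjoint : (n : ℕ) → Edge n → Edge n → Set
Disjoint n e f =
  let (a , b) = ends n e ; (c , d) = ends n f in
  a ≢ c × a ≢ d × b ≢ c × b ≢ d

PairwiseIndependent : (n : ℕ) → List (Graph n) → Set
PairwiseIndependent n S =
  (e f : Edge n) → Disjoint n e f →
  Pr S (λ g → X n e g ∧ X n f g) ≡ Data.Rational._*_ (Pr S (X n e)) (Pr S (X n f))

-- Write c_m(o) for the number of subsets s of an m-element set with 3 ∣ o + |s|.
-- Under G³_{n,1/2} with N potential edges, requiring an edge to be present shifts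
-- the offset by one, so P(e) = c_{N-1}(1) / c_N(0) and P(e ∧ f) = c_{N-2}(2) / c_N(0).
-- With (x, y, z) = (c_{N-2}(0), c_{N-2}(1), c_{N-2}(2)), the recurrence
-- c_{m+1}(o) = c_m(o+1) + c_m(o) turns P(e ∧ f) = P(e) P(f) into
-- z (x + 2y + z) = (y + z)², that is x z = y². But for m ≥ 2 the triple
-- (c_m(0), c_m(1), c_m(2)) consists of the two values k+1 and k+2, both taken
-- (this shape is preserved by the recurrence), and no such triple has x z = y².
module Submission where

open import Defs
open import Data.Bool using (Bool; true; false; _∧_; if_then_else_)
import Data.Bool as Bool
open import Data.Bool.Properties using (∧-identityʳ; ∧-zeroʳ)
open import Data.Fin using (Fin; zero; suc; toℕ)
open import Data.Fin.Subset using (Subset; inside; outside; ∣_∣)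
open import Data.Fin.Subset.Properties using (_∈?_)
import Data.Integer as ℤ
import Data.Integer.Properties as ℤ
open import Data.List using (List; []; _∷_; _++_; map; filter; length; allFin)
import Data.List as List
open import Data.List.Membership.Propositional using (_∈_)
open import Data.List.Membership.Propositional.Properties
  using (∈-filter⁺; ∈-concatMap⁺; ∈-map⁺; ∈-allFin)
import Data.List.Relation.Unary.Any as Any
open import Data.List.Relation.Unary.Any.Properties using (lookup-index)
open import Data.Nat
  using (ℕ; zero; suc; pred; _+_; _*_; _<_; _≤_; _<?_; s≤s; z≤n)
open import Data.Nat.Divisibility using (_∣?_; _∣0; ∣m+n∣m⇒∣n; ∣m∣n⇒∣m+n; ∣-refl)
open import Data.Nat.Properties
  using (+-commutativeSemigroup; +-suc; +-assoc; +-identityʳ; +-cancelˡ-≡; *-assoc; *-cancelʳ-≡;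
         *-monoˡ-<; *-monoʳ-<; *-mono-<; <⇒≢; >⇒≢; n<1+n)
open import Algebra.Properties.CommutativeSemigroup +-commutativeSemigroup using (interchange)
open import Data.Nat.Tactic.RingSolver using (solve-∀)
open import Data.Product using (∃-syntax; _,_; proj₁; proj₂)
open import Data.Rational using (_/_)
import Data.Rational as ℚ
open import Data.Rational.Properties using (toℚᵘ-cong; toℚᵘ-homo-*; toℚᵘ-fromℚᵘ)
import Data.Rational.Unnormalised as ℚᵘ
import Data.Rational.Unnormalised.Properties as ℚᵘ
open import Data.Vec using (_∷_; fromList; lookup)
open import Function using (_∘_; mk⇔)
open import Relation.Nullary using (¬_; does; yes; no)
open import Relation.Nullary.Decidable using (⌊_⌋; does-⇔; dec-true)
open import Level using (Level)
open import Relation.Unary using (Pred; Decidable)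
open import Relation.Binary.PropositionalEquality

a/n≡b/n*c/n⇒a*n≡b*c : ∀ a b c d →
  ℤ.+ a / suc d ≡ (ℤ.+ b / suc d) ℚ.* (ℤ.+ c / suc d) → a * suc d ≡ b * c
a/n≡b/n*c/n⇒a*n≡b*c a b c d eq =
  *-cancelʳ-≡ (a * suc d) (b * c) (suc d) (trans (*-assoc a (suc d) (suc d)) (ℤ.+-injective cross))
  where
  frac : ℕ → ℚᵘ.ℚᵘ
  frac x = ℚᵘ.mkℚᵘ (ℤ.+ x) d
  unnormalised : frac a ℚᵘ.≃ frac b ℚᵘ.* frac c
  unnormalised = begin
    frac a                                             ≈⟨ toℚᵘ-fromℚᵘ (frac a) ⟨
    ℚ.toℚᵘ (ℤ.+ a / suc d)                             ≈⟨ toℚᵘ-cong eq ⟩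
    ℚ.toℚᵘ ((ℤ.+ b / suc d) ℚ.* (ℤ.+ c / suc d))        ≈⟨ toℚᵘ-homo-* (ℤ.+ b / suc d) (ℤ.+ c / suc d) ⟩
    ℚ.toℚᵘ (ℤ.+ b / suc d) ℚᵘ.* ℚ.toℚᵘ (ℤ.+ c / suc d)  ≈⟨ ℚᵘ.*-cong (toℚᵘ-fromℚᵘ (frac b)) (toℚᵘ-fromℚᵘ (frac c)) ⟩
    frac b ℚᵘ.* frac c                                 ∎
    where open ℚᵘ.≃-Reasoning
  cross : ℤ.+ (a * (suc d * suc d)) ≡ ℤ.+ (b * c * suc d)
  cross = begin
    ℤ.+ (a * (suc d * suc d))         ≡⟨ ℤ.pos-* a (suc d * suc d) ⟩
    ℤ.+ a ℤ.* ℤ.+ (suc d * suc d)     ≡⟨ ℚᵘ.drop-*≡* unnormalised ⟩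
    (ℤ.+ b ℤ.* ℤ.+ c) ℤ.* ℤ.+ suc d   ≡⟨ cong (ℤ._* ℤ.+ suc d) (ℤ.pos-* b c) ⟨
    ℤ.+ (b * c) ℤ.* ℤ.+ suc d         ≡⟨ ℤ.pos-* (b * c) (suc d) ⟨
    ℤ.+ (b * c * suc d)               ∎
    where open ≡-Reasoning

open ≡-Reasoning

count : {A : Set} → (A → Bool) → List A → ℕ
count p []       = 0
count p (x ∷ xs) = if p x then suc (count p xs) else count p xs

module _ {A : Set} where

  count-++ : (p : A → Bool) (xs ys : List A) → count p (xs ++ ys) ≡ count p xs + count p ys
  count-++ p []       ys = refl
  count-++ p (x ∷ xs) ys with p x
  ... | true  = cong suc (count-++ p xs ys)
  ... | false = count-++ p xs ys

  count-map : {B : Set} (p : B → Bool) (f : A → B) (xs : List A) →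
              count p (map f xs) ≡ count (p ∘ f) xs
  count-map p f []       = refl
  count-map p f (x ∷ xs) with p (f x)
  ... | true  = cong suc (count-map p f xs)
  ... | false = count-map p f xs

  count-cong : {p q : A → Bool} → (∀ x → p x ≡ q x) → (xs : List A) → count p xs ≡ count q xs
  count-cong p≗q []       = refl
  count-cong {q = q} p≗q (x ∷ xs) rewrite p≗q x with q x
  ... | true  = cong suc (count-cong p≗q xs)
  ... | false = count-cong p≗q xs

  count-false : {p : A → Bool} → (∀ x → p x ≡ false) → (xs : List A) → count p xs ≡ 0
  count-false p≗false []       = refl
  count-false p≗false (x ∷ xs) rewrite p≗false x = count-false p≗false xs

  length-filter : {ℓ : Level} {P : Pred A ℓ} (P? : Decidable P) (xs : List A) →
                  length (filter P? xs) ≡ count (does ∘ P?) xs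
  length-filter P? []       = refl
  length-filter P? (x ∷ xs) with does (P? x)
  ... | true  = cong suc (length-filter P? xs)
  ... | false = length-filter P? xs

  count-filter : {ℓ : Level} {P : Pred A ℓ} (P? : Decidable P) (p : A → Bool) (xs : List A) →
                 count p (filter P? xs) ≡ count (λ x → does (P? x) ∧ p x) xs
  count-filter P? p []       = refl
  count-filter P? p (x ∷ xs) with does (P? x)
  ... | false = count-filter P? p xs
  ... | true with p x
  ...   | true  = cong suc (count-filter P? p xs)
  ...   | false = count-filter P? p xs

count-allSubsets-suc : ∀ m (p : Subset (suc m) → Bool) →
  count p (allSubsets (suc m)) ≡
  count (p ∘ (inside ∷_)) (allSubsets m) + count (p ∘ (outside ∷_)) (allSubsets m)
count-allSubsets-suc m p = begin
  count p (map (inside ∷_) (allSubsets m) ++ map (outside ∷_) (allSubsets m))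
    ≡⟨ count-++ p (map (inside ∷_) (allSubsets m)) _ ⟩
  count p (map (inside ∷_) (allSubsets m)) + count p (map (outside ∷_) (allSubsets m))
    ≡⟨ cong₂ _+_ (count-map p _ (allSubsets m)) (count-map p _ (allSubsets m)) ⟩
  count (p ∘ (inside ∷_)) (allSubsets m) + count (p ∘ (outside ∷_)) (allSubsets m) ∎

-- The offset o stands for elements already chosen outside Fin m.
residueCount : ℕ → ℕ → ℕ → ℕ
residueCount k m o = count (λ s → does (k ∣? o + ∣ s ∣)) (allSubsets m)

does-∣?-+-suc : ∀ k o n → does (k ∣? o + suc n) ≡ does (k ∣? suc o + n)
does-∣?-+-suc k o n = cong (λ t → does (k ∣? t)) (+-suc o n)

residueCount-suc : ∀ k m o → residueCount k (suc m) o ≡ residueCount k m (suc o) + residueCount k m o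
residueCount-suc k m o = begin
  residueCount k (suc m) o
    ≡⟨ count-allSubsets-suc m _ ⟩
  count (λ s → does (k ∣? o + suc ∣ s ∣)) (allSubsets m) + residueCount k m o
    ≡⟨ cong (_+ residueCount k m o) (count-cong (λ s → does-∣?-+-suc k o ∣ s ∣) (allSubsets m)) ⟩
  residueCount k m (suc o) + residueCount k m o ∎

residueCount-periodic : ∀ k m o → residueCount k m (k + o) ≡ residueCount k m o
residueCount-periodic k m o = count-cong shift (allSubsets m)
  where
  shift : ∀ s → does (k ∣? k + o + ∣ s ∣) ≡ does (k ∣? o + ∣ s ∣)
  shift s rewrite +-assoc k o ∣ s ∣ =
    does-⇔ (mk⇔ (λ k∣ → ∣m+n∣m⇒∣n k∣ ∣-refl) (∣m∣n⇒∣m+n ∣-refl)) (k ∣? _) (k ∣? _)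

residueCount-0≡suc : ∀ k m → ∃[ d ] residueCount k m 0 ≡ suc d
residueCount-0≡suc k zero rewrite dec-true (k ∣? 0) (k ∣0) = 0 , refl
residueCount-0≡suc k (suc m) with residueCount-0≡suc k m
... | d , eq = residueCount k m 1 + d , (begin
  residueCount k (suc m) 0                ≡⟨ residueCount-suc k m 0 ⟩
  residueCount k m 1 + residueCount k m 0 ≡⟨ cong (residueCount k m 1 +_) eq ⟩
  residueCount k m 1 + suc d              ≡⟨ +-suc _ d ⟩
  suc (residueCount k m 1 + d)            ∎)

-- ⌊_⌋ is isYes, which does not reduce through Dec.map′ on its own.
⌊suc-∈?⌋ : ∀ {m} (i : Fin m) x (s : Subset m) → ⌊ suc i ∈? (x ∷ s) ⌋ ≡ ⌊ i ∈? s ⌋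
⌊suc-∈?⌋ i x s with i ∈? s
... | yes _ = refl
... | no  _ = refl

count-member : ∀ k m o (i : Fin (suc m)) →
  count (λ s → does (k ∣? o + ∣ s ∣) ∧ ⌊ i ∈? s ⌋) (allSubsets (suc m)) ≡ residueCount k m (suc o)
count-member k m o zero = begin
  count _ (allSubsets (suc m))
    ≡⟨ count-allSubsets-suc m _ ⟩
  count (λ s → does (k ∣? o + suc ∣ s ∣) ∧ true) (allSubsets m)
    + count (λ s → does (k ∣? o + ∣ s ∣) ∧ false) (allSubsets m)
    ≡⟨ cong₂ _+_ (count-cong (λ s → trans (∧-identityʳ _) (does-∣?-+-suc k o ∣ s ∣)) (allSubsets m))
                 (count-false (λ _ → ∧-zeroʳ _) (allSubsets m)) ⟩
  residueCount k m (suc o) + 0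
    ≡⟨ +-identityʳ _ ⟩
  residueCount k m (suc o) ∎
count-member k (suc m) o (suc i) = begin
  count _ (allSubsets (suc (suc m)))
    ≡⟨ count-allSubsets-suc (suc m) _ ⟩
  count (λ s → does (k ∣? o + suc ∣ s ∣) ∧ ⌊ suc i ∈? (inside ∷ s) ⌋) (allSubsets (suc m))
    + count (λ s → does (k ∣? o + ∣ s ∣) ∧ ⌊ suc i ∈? (outside ∷ s) ⌋) (allSubsets (suc m))
    ≡⟨ cong₂ _+_ (count-cong (λ s → cong₂ _∧_ (does-∣?-+-suc k o ∣ s ∣) (⌊suc-∈?⌋ i inside s)) (allSubsets (suc m)))
                 (count-cong (λ s → cong (_ ∧_) (⌊suc-∈?⌋ i outside s)) (allSubsets (suc m))) ⟩
  count (λ s → does (k ∣? suc o + ∣ s ∣) ∧ ⌊ i ∈? s ⌋) (allSubsets (suc m))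
    + count (λ s → does (k ∣? o + ∣ s ∣) ∧ ⌊ i ∈? s ⌋) (allSubsets (suc m))
    ≡⟨ cong₂ _+_ (count-member k m (suc o) i) (count-member k m o i) ⟩
  residueCount k m (suc (suc o)) + residueCount k m (suc o)
    ≡⟨ residueCount-suc k m (suc o) ⟨
  residueCount k (suc m) (suc o) ∎

count-member-zero-suc : ∀ k m o (j : Fin (suc m)) →
  count (λ s → does (k ∣? o + ∣ s ∣) ∧ (⌊ zero ∈? s ⌋ ∧ ⌊ suc j ∈? s ⌋)) (allSubsets (suc (suc m)))
    ≡ residueCount k m (suc (suc o))
count-member-zero-suc k m o j = begin
  count _ (allSubsets (suc (suc m)))
    ≡⟨ count-allSubsets-suc (suc m) _ ⟩
  count (λ s → does (k ∣? o + suc ∣ s ∣) ∧ ⌊ suc j ∈? (inside ∷ s) ⌋) (allSubsets (suc m))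
    + count (λ s → does (k ∣? o + ∣ s ∣) ∧ false) (allSubsets (suc m))
    ≡⟨ cong₂ _+_ (count-cong (λ s → cong₂ _∧_ (does-∣?-+-suc k o ∣ s ∣) (⌊suc-∈?⌋ j inside s)) (allSubsets (suc m)))
                 (count-false (λ _ → ∧-zeroʳ _) (allSubsets (suc m))) ⟩
  count (λ s → does (k ∣? suc o + ∣ s ∣) ∧ ⌊ j ∈? s ⌋) (allSubsets (suc m)) + 0
    ≡⟨ +-identityʳ _ ⟩
  count (λ s → does (k ∣? suc o + ∣ s ∣) ∧ ⌊ j ∈? s ⌋) (allSubsets (suc m))
    ≡⟨ count-member k m (suc o) j ⟩
  residueCount k m (suc (suc o)) ∎

-- The constructor name lists the coordinates holding the larger value k + 2.
data NearlyEqual : ℕ → ℕ → ℕ → Set where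
  hi-x  : ∀ k → NearlyEqual (2 + k) (suc k) (suc k)
  hi-y  : ∀ k → NearlyEqual (suc k) (2 + k) (suc k)
  hi-z  : ∀ k → NearlyEqual (suc k) (suc k) (2 + k)
  hi-xy : ∀ k → NearlyEqual (2 + k) (2 + k) (suc k)
  hi-xz : ∀ k → NearlyEqual (2 + k) (suc k) (2 + k)
  hi-yz : ∀ k → NearlyEqual (suc k) (2 + k) (2 + k)

NearlyEqual-resp : ∀ {x y z x′ y′ z′} → x ≡ x′ → y ≡ y′ → z ≡ z′ →
                   NearlyEqual x y z → NearlyEqual x′ y′ z′
NearlyEqual-resp refl refl refl t = t

NearlyEqual-step : ∀ {x y z} → NearlyEqual x y z → NearlyEqual (y + x) (z + y) (x + z)
NearlyEqual-step (hi-x k)  = NearlyEqual-resp (interchange 1 2 k k) (interchange 1 1 k k) (interchange 2 1 k k) (hi-xz (suc (k + k)))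
NearlyEqual-step (hi-y k)  = NearlyEqual-resp (interchange 2 1 k k) (interchange 1 2 k k) (interchange 1 1 k k) (hi-xy (suc (k + k)))
NearlyEqual-step (hi-z k)  = NearlyEqual-resp (interchange 1 1 k k) (interchange 2 1 k k) (interchange 1 2 k k) (hi-yz (suc (k + k)))
NearlyEqual-step (hi-xy k) = NearlyEqual-resp (interchange 2 2 k k) (interchange 1 2 k k) (interchange 2 1 k k) (hi-x (suc (suc (k + k))))
NearlyEqual-step (hi-xz k) = NearlyEqual-resp (interchange 1 2 k k) (interchange 2 1 k k) (interchange 2 2 k k) (hi-z (suc (suc (k + k))))
NearlyEqual-step (hi-yz k) = NearlyEqual-resp (interchange 2 1 k k) (interchange 2 2 k k) (interchange 1 2 k k) (hi-y (suc (suc (k + k))))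

residueCounts-nearlyEqual : ∀ m →
  NearlyEqual (residueCount 3 (2 + m) 0) (residueCount 3 (2 + m) 1) (residueCount 3 (2 + m) 2)
residueCounts-nearlyEqual zero    = hi-z 0
residueCounts-nearlyEqual (suc m) =
  NearlyEqual-resp (sym (residueCount-suc 3 (2 + m) 0)) (sym (residueCount-suc 3 (2 + m) 1)) third
    (NearlyEqual-step (residueCounts-nearlyEqual m))
  where
  third : residueCount 3 (2 + m) 0 + residueCount 3 (2 + m) 2 ≡ residueCount 3 (3 + m) 2
  third = begin
    residueCount 3 (2 + m) 0 + residueCount 3 (2 + m) 2
      ≡⟨ cong (_+ residueCount 3 (2 + m) 2) (residueCount-periodic 3 (2 + m) 0) ⟨
    residueCount 3 (2 + m) 3 + residueCount 3 (2 + m) 2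
      ≡⟨ residueCount-suc 3 (2 + m) 2 ⟨
    residueCount 3 (3 + m) 2 ∎

NearlyEqual⇒xz≢y² : ∀ {x y z} → NearlyEqual x y z → x * z ≢ y * y
NearlyEqual⇒xz≢y² (hi-x k)  = >⇒≢ (*-monoˡ-< (suc k) (n<1+n (suc k)))
NearlyEqual⇒xz≢y² (hi-y k)  = <⇒≢ (*-mono-< (n<1+n (suc k)) (n<1+n (suc k)))
NearlyEqual⇒xz≢y² (hi-z k)  = >⇒≢ (*-monoʳ-< (suc k) (n<1+n (suc k)))
NearlyEqual⇒xz≢y² (hi-xy k) = <⇒≢ (*-monoʳ-< (2 + k) (n<1+n (suc k)))
NearlyEqual⇒xz≢y² (hi-xz k) = >⇒≢ (*-mono-< (n<1+n (suc k)) (n<1+n (suc k)))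
NearlyEqual⇒xz≢y² (hi-yz k) = <⇒≢ (*-monoˡ-< (2 + k) (n<1+n (suc k)))

z[z+y+[y+x]]≡[z+y]²⇒xz≡y² : ∀ x y z → z * ((z + y) + (y + x)) ≡ (z + y) * (z + y) → x * z ≡ y * y
z[z+y+[y+x]]≡[z+y]²⇒xz≡y² x y z eq =
  +-cancelˡ-≡ (z * z + (y * z + y * z)) _ _ (trans (sym (expand-lhs x y z)) (trans eq (expand-rhs y z)))
  where
  expand-lhs : ∀ x y z → z * ((z + y) + (y + x)) ≡ (z * z + (y * z + y * z)) + x * z
  expand-lhs = solve-∀
  expand-rhs : ∀ y z → (z + y) * (z + y) ≡ (z * z + (y * z + y * z)) + y * y
  expand-rhs = solve-∀

residueCounts-dependent : ∀ m →
  residueCount 3 (1 + m) 2 * residueCount 3 (3 + m) 0 ≢ residueCount 3 (2 + m) 1 * residueCount 3 (2 + m) 1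
residueCounts-dependent zero    ()
residueCounts-dependent (suc m) eq =
  NearlyEqual⇒xz≢y² (residueCounts-nearlyEqual m) (z[z+y+[y+x]]≡[z+y]²⇒xz≡y² x y z recurrence-applied)
  where
  x = residueCount 3 (2 + m) 0
  y = residueCount 3 (2 + m) 1
  z = residueCount 3 (2 + m) 2
  y′ = residueCount 3 (3 + m) 1
  y′≡z+y : y′ ≡ z + y
  y′≡z+y = residueCount-suc 3 (2 + m) 1
  recurrence-applied : z * ((z + y) + (y + x)) ≡ (z + y) * (z + y)
  recurrence-applied = begin
    z * ((z + y) + (y + x))
      ≡⟨ cong (z *_) (cong (_+ (y + x)) y′≡z+y) ⟨
    z * (y′ + (y + x))
      ≡⟨ cong (z *_) (cong (y′ +_) (residueCount-suc 3 (2 + m) 0)) ⟨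
    z * (y′ + residueCount 3 (3 + m) 0)
      ≡⟨ cong (z *_) (residueCount-suc 3 (3 + m) 0) ⟨
    z * residueCount 3 (4 + m) 0
      ≡⟨ eq ⟩
    y′ * y′
      ≡⟨ cong₂ _*_ y′≡z+y y′≡z+y ⟩
    (z + y) * (z + y) ∎

does-≟-true : ∀ b → does (b Bool.≟ true) ≡ b
does-≟-true true  = refl
does-≟-true false = refl

Pr-count : {A : Set} (S : List A) (P : A → Bool) {d : ℕ} →
           length S ≡ suc d → Pr S P ≡ ℤ.+ count P S / suc d
Pr-count S P eq rewrite eq =
  cong (λ c → ℤ.+ c / _) (trans (length-filter _ S) (count-cong (does-≟-true ∘ P) S))

Pr-Gk : ∀ k n (P : Graph n → Bool) {d} → residueCount k (E n) 0 ≡ suc d →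
        Pr (Gk k n) P ≡ ℤ.+ count (λ g → does (k ∣? 0 + ∣ g ∣) ∧ P g) (allGraphs n) / suc d
Pr-Gk k n P {d} |Gk|≡ = begin
  Pr (Gk k n) P
    ≡⟨ Pr-count (Gk k n) P (trans (length-filter (λ g → k ∣? edgeCount n g) (allGraphs n)) |Gk|≡) ⟩
  ℤ.+ count P (Gk k n) / suc d
    ≡⟨ cong (λ c → ℤ.+ c / suc d) (count-filter (λ g → k ∣? edgeCount n g) P (allGraphs n)) ⟩
  ℤ.+ count (λ g → does (k ∣? 0 + ∣ g ∣) ∧ P g) (allGraphs n) / suc d ∎

lookup-fromList : {A : Set} (xs : List A) (i : Fin (length xs)) → lookup (fromList xs) i ≡ List.lookup xs i
lookup-fromList (x ∷ xs) zero    = refl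
lookup-fromList (x ∷ xs) (suc i) = lookup-fromList xs i

edge-between : ∀ n (i j : Fin n) → toℕ i < toℕ j → ∃[ e ] ends n e ≡ (i , j)
edge-between n i j i<j = Any.index ij∈ , trans (lookup-fromList (edgeList n) _) (sym (lookup-index ij∈))
  where
  ij∈ : (i , j) ∈ edgeList n
  ij∈ = ∈-filter⁺ (λ p → toℕ (proj₁ p) <? toℕ (proj₂ p))
          (∈-concatMap⁺ (λ i′ → map (i′ ,_) (allFin n)) (Any.map (λ { refl → ∈-map⁺ (i ,_) (∈-allFin j) }) (∈-allFin i))) i<j

-- The first potential edge is {0, 1}; the edge {2, 3} is disjoint from it.
disjoint-from-first-edge : ∀ k → ∃[ j ] Disjoint (4 + k) zero (suc j)
disjoint-from-first-edge k with edge-between (4 + k) (suc (suc zero)) (suc (suc (suc zero))) (s≤s (s≤s (s≤s z≤n)))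
... | zero  , ()
... | suc j , ends≡23 = j , disjoint
  where
  disjoint : Disjoint (4 + k) zero (suc j)
  disjoint rewrite ends≡23 = (λ ()) , (λ ()) , (λ ()) , (λ ())

first-edges-dependent : ∀ k (j : Fin (pred (E (4 + k)))) →
  Pr (Gk 3 (4 + k)) (λ g → X (4 + k) zero g ∧ X (4 + k) (suc j) g) ≢
  Pr (Gk 3 (4 + k)) (X (4 + k) zero) ℚ.* Pr (Gk 3 (4 + k)) (X (4 + k) (suc j))
first-edges-dependent k j independent =
  residueCounts-dependent M (subst (λ t → residueCount 3 (1 + M) 2 * t ≡ y * y) (sym |S|≡suc)
    (a/n≡b/n*c/n⇒a*n≡b*c (residueCount 3 (1 + M) 2) y y d (begin
      ℤ.+ residueCount 3 (1 + M) 2 / suc d                   ≡⟨ Pr-both ⟨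
      Pr S (λ g → X n zero g ∧ X n (suc j) g)                ≡⟨ independent ⟩
      Pr S (X n zero) ℚ.* Pr S (X n (suc j))                 ≡⟨ cong₂ ℚ._*_ (Pr-edge zero) (Pr-edge (suc j)) ⟩
      (ℤ.+ y / suc d) ℚ.* (ℤ.+ y / suc d)                    ∎)))
  where
  n = 4 + k
  S = Gk 3 n
  M = pred (pred (pred (E n)))
  y = residueCount 3 (2 + M) 1
  d = proj₁ (residueCount-0≡suc 3 (E n))
  |S|≡suc : residueCount 3 (E n) 0 ≡ suc d
  |S|≡suc = proj₂ (residueCount-0≡suc 3 (E n))
  Pr-both : Pr S (λ g → X n zero g ∧ X n (suc j) g) ≡ ℤ.+ residueCount 3 (1 + M) 2 / suc d
  Pr-both = trans (Pr-Gk 3 n _ |S|≡suc) (cong (λ c → ℤ.+ c / suc d) (count-member-zero-suc 3 (suc M) 0 j))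
  Pr-edge : ∀ e → Pr S (X n e) ≡ ℤ.+ y / suc d
  Pr-edge e = trans (Pr-Gk 3 n _ |S|≡suc) (cong (λ c → ℤ.+ c / suc d) (count-member 3 (2 + M) 0 e))

lemma49 : ∀ n → 4 ≤ n → ¬ PairwiseIndependent n (Gk 3 n)
lemma49 (suc (suc (suc (suc k)))) (s≤s (s≤s (s≤s (s≤s _)))) independent =
  let j , disjoint = disjoint-from-first-edge k
  in  first-edges-dependent k j (independent zero (suc j) disjoint)
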